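{- $R_3(\mathcal{B}(K_4),2)=6$.
   Context: For a graph $G$, a hypergraph $H$ is a Berge-$G$ hypergraph if there are an injective map $\phi:V(G)\to V(H)$ and pairwise distinct hyperedges $e_{xy}\in E(H)$, one for each $xy\in E(G)$, with $\phi(x),\phi(y)\in e_{xy}$. $\mathcal{B}(G)$ denotes the family of all Berge-$G$ hypergraphs. For a family $\mathcal{H}$ of $3$-uniform hypergraphs, $R_3(\mathcal{H},k)$ is the smallest $n$ such that every $k$-coloring of the hyperedges of the complete $3$-uniform hypergraph $K_n^3$ contains a monochromatic subhypergraph belonging to $\mathcal{H}$. -}

module Defs where

open import Data.Bool using (Bool; T)
open import Data.Fin using (Fin)
open import Data.Fin.Properties using (any?) renaming (_≟_ to _≟ᶠ_)
open import Data.Fin.Subset using (Subset; ∣_∣; _∈_)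
open import Data.Fin.Subset.Properties using (_∈?_)
open import Data.Nat using (ℕ; _≤_; _≟_)
open import Data.Product using (Σ-syntax; ∃-syntax; _×_; _,_; proj₁)
open import Data.Vec using (tabulate)
open import Function using (Injective)
open import Level using (0ℓ)
open import Relation.Binary.PropositionalEquality using (_≡_)
open import Relation.Nullary.Decidable using (does; isYes; toWitness; _×-dec_)
open import Relation.Unary using (Pred)

-- The edge set is Boolean-valued, so that an element of Edge is determined by
-- its underlying vertex subset: distinct edges are distinct subsets.
record Hypergraph : Set where
  field
    order  : ℕ
    isEdge : Subset order → Bool

  Vertex : Set
  Vertex = Fin order

  Edge : Set
  Edge = ∃[ p ] T (isEdge p)

open Hypergraph public

Uniform : ℕ → Hypergraph → Set
Uniform r H = ∀ (e : Edge H) → ∣ proj₁ e ∣ ≡ r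

-- A finite simple graph: the edge xy is the two-element subset {x , y}.
record Graph : Set where
  field
    hypergraph : Hypergraph
    uniform    : Uniform 2 hypergraph

complete : ℕ → ℕ → Hypergraph
complete r n = record { order = n ; isEdge = λ p → isYes (∣ p ∣ ≟ r) }

complete-uniform : ∀ r n → Uniform r (complete r n)
complete-uniform r n (p , h) = toWitness h

K : ℕ → Graph
K n = record { hypergraph = complete 2 n ; uniform = complete-uniform 2 n }

record IsBerge (G : Graph) (H : Hypergraph) : Set where
  open Graph G renaming (hypergraph to G′)
  field
    φ           : Vertex G′ → Vertex H
    φ-injective : Injective _≡_ _≡_ φ
    ε           : Edge G′ → Edge H
    ε-injective : Injective _≡_ _≡_ ε
    incident    : ∀ (xy : Edge G′) (x : Vertex G′) →
                  x ∈ proj₁ xy → φ x ∈ proj₁ (ε xy)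

Family : Set₁
Family = Pred Hypergraph 0ℓ

ℬ : Graph → Family
ℬ = IsBerge

image : ∀ {m n} → (Fin m → Fin n) → Subset m → Subset n
image f p = tabulate λ y → does (any? λ x → (x ∈? p) ×-dec (f x ≟ᶠ y))

Coloring : ℕ → Hypergraph → Set
Coloring k H = Edge H → Fin k

-- H is, up to renaming its vertices along ι, a subhypergraph of L all of whose
-- edges have the same colour.  The vertex set of H may be a proper part of
-- that of L.
record MonochromaticIn {k} (L : Hypergraph) (χ : Coloring k L) (H : Hypergraph) : Set where
  field
    ι             : Vertex H → Vertex L
    ι-injective   : Injective _≡_ _≡_ ι
    colour        : Fin k
    monochromatic : ∀ (e : Edge H) →
                    Σ[ h ∈ T (isEdge L (image ι (proj₁ e))) ]
                      χ (image ι (proj₁ e) , h) ≡ colour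

-- Subhypergraphs of the complete r-uniform hypergraph are r-uniform, so only
-- the r-uniform members of ℋ matter here.
Arrows : (r : ℕ) → Family → (k n : ℕ) → Set
Arrows r ℋ k n =
  ∀ (χ : Coloring k (complete r n)) →
  ∃[ H ] ℋ H × MonochromaticIn (complete r n) χ H

IsLeast : Pred ℕ 0ℓ → Pred ℕ 0ℓ
IsLeast P n = P n × (∀ m → P m → n ≤ m)

R[_]⟨_,_⟩≡_ : (r : ℕ) → Family → (k n : ℕ) → Set
R[ r ]⟨ ℋ , k ⟩≡ n = IsLeast (Arrows r ℋ k) n

-- Upper bound: every six of the ten triples on five vertices contain a
-- Berge-K₄, so a colouring of K₆³ without a monochromatic one splits the ten
-- triples avoiding a fixed sixth vertex 5–5; but for every 5–5 split some
-- triple through the sixth vertex completes both halves to a Berge-K₄.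
-- Lower bound: a Berge-K₄ has six hyperedges, while K₅³ has only ten, which can
-- be split into two classes of five.
module Submission where

open import Defs

open import Data.Bool using (true; T)
open import Data.Bool.Properties using (T-irrelevant) renaming (_≟_ to _≟ᵇ_)
open import Data.Fin using (Fin; zero; suc; punchIn; inject≤; remQuot; quotient; remainder;
  combine; toℕ; fromℕ<)
open import Data.Fin.Properties using (all?; any?; suc-injective; punchIn-injective;
  inject≤-injective; combine-remQuot; injective⇒≤; toℕ-fromℕ<) renaming (_≟_ to _≟ᶠ_)
open import Data.Fin.Subset using (Subset; ∣_∣; _∈_; _⊆_; inside; outside)
open import Data.Fin.Subset.Properties using (_∈?_; _⊆?_; ⊆-antisym)
open import Data.List using (List; []; _∷_; _++_; map; length; lookup; allFin)
open import Data.List.Membership.Propositional using (find) renaming (_∈_ to _∈ᴸ_; _∉_ to _∉ᴸ_)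
open import Data.List.Membership.Propositional.Properties using (∈-map⁺; ∈-map⁻; ∈-++⁺ˡ; ∈-++⁺ʳ)
open import Data.List.Relation.Unary.All as All using (All; []; _∷_)
open import Data.List.Relation.Unary.Any as Any using (Any; here; there; index)
open import Data.List.Relation.Unary.Any.Properties using (lookup-index; map⁻)
open import Data.Nat using (ℕ; zero; suc; _*_; _≤_; _<_; _≤?_; _≟_)
open import Data.Nat.Properties using (<⇒≱; ≤-refl; ≮⇒≥)
open import Data.Product using (Σ-syntax; ∃-syntax; _×_; _,_; proj₁; proj₂; map₁; map₂; uncurry)
open import Data.Sum using (_⊎_; inj₁; inj₂) renaming (map₂ to map₂ᵘ)
open import Data.Unit using (tt)
open import Data.Vec using ([]; _∷_)
open import Data.Vec.Properties using (≡-dec; lookup∘tabulate; []=⇒lookup; lookup⇒[]=)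
open import Function using (Injective; id; _∘_)
open import Level using (0ℓ)
open import Relation.Binary using (REL; Decidable; DecidableEquality)
open import Relation.Binary.PropositionalEquality
  using (_≡_; refl; sym; trans; cong; cong₂; subst; module ≡-Reasoning)
open import Relation.Nullary using (Dec; yes; no; ¬_; ¬?; contradiction)
open import Relation.Nullary.Decidable
  using (does; isYes; toWitness; fromWitness; dec-true; _×-dec_; _⊎-dec_; _→-dec_; T?)

_≟ˢ_ : ∀ {n} → DecidableEquality (Subset n)
_≟ˢ_ = ≡-dec _≟ᵇ_

-- Perfect matchings between two finite lists

removals : ∀ {A : Set} → List A → List (A × List A)
removals []       = []
removals (x ∷ xs) = (x , xs) ∷ map (map₂ (x ∷_)) (removals xs)

removals-split : ∀ {A : Set} {x y : A} {xs xs′} → (y , xs′) ∈ᴸ removals xs → x ∈ᴸ xs →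
                 x ≡ y ⊎ x ∈ᴸ xs′
removals-split {xs = _ ∷ _} (here refl) (here refl) = inj₁ refl
removals-split {xs = _ ∷ _} (here refl) (there i)   = inj₂ i
removals-split {xs = _ ∷ _} (there m)   i with ∈-map⁻ _ m
removals-split {xs = _ ∷ _} (there m)   (here refl) | _ , _ , refl = inj₂ (here refl)
removals-split {xs = _ ∷ _} (there m)   (there i)   | _ , n , refl =
  map₂ᵘ there (removals-split n i)

module _ {A B : Set} (_∼_ : REL A B 0ℓ) where

  -- The recursion runs along `es` and deletes each chosen partner from `ps`, so both lists are used
  -- up. The clause `e ∉ᴸ es` keeps partners distinct as elements, not just as positions.
  PerfectMatching : List A → List B → Set
  PerfectMatching ps []       = ps ≡ []
  PerfectMatching ps (e ∷ es) =
    Any (λ (p , ps′) → p ∼ e × PerfectMatching ps′ es) (removals ps) × e ∉ᴸ es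

  perfectMatching? : Decidable _∼_ → DecidableEquality B → ∀ ps es → Dec (PerfectMatching ps es)
  perfectMatching? _∼?_ _≟_ []      []       = yes refl
  perfectMatching? _∼?_ _≟_ (_ ∷ _) []       = no λ ()
  perfectMatching? _∼?_ _≟_ ps      (e ∷ es) =
    Any.any? (λ (p , ps′) → (p ∼? e) ×-dec perfectMatching? _∼?_ _≟_ ps′ es) (removals ps)
    ×-dec ¬? (Any.any? (e ≟_) es)

  partner : ∀ {p ps es} → PerfectMatching ps es → p ∈ᴸ ps → ∃[ e ] e ∈ᴸ es × p ∼ e
  partner {es = []}    refl    ()
  partner {es = e ∷ _} (m , _) i with _ , r , p∼e , m′ ← find m with removals-split r i
  ... | inj₁ refl = e , here refl , p∼e
  ... | inj₂ j    = map₂ (map₁ there) (partner m′ j)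

  -- If just one of `p` and `q` is paired with the head `e`, then equal partners would make `e`
  -- occur again in the tail, against `e ∉ᴸ es`.
  partner-injective : ∀ {p q ps es} (m : PerfectMatching ps es) (i : p ∈ᴸ ps) (j : q ∈ᴸ ps) →
                      proj₁ (partner m i) ≡ proj₁ (partner m j) → p ≡ q
  partner-injective {es = []}    refl    ()
  partner-injective {es = e ∷ _} (m , e∉) i j eq
    with _ , r , _ , m′ ← find m with removals-split r i | removals-split r j
  ... | inj₁ refl | inj₁ refl = refl
  ... | inj₁ refl | inj₂ j′   =
    contradiction (subst (_∈ᴸ _) (sym eq) (proj₁ (proj₂ (partner m′ j′)))) e∉
  ... | inj₂ i′   | inj₁ refl =
    contradiction (subst (_∈ᴸ _) eq (proj₁ (proj₂ (partner m′ i′)))) e∉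
  ... | inj₂ i′   | inj₂ j′   = partner-injective m′ i′ j′ eq

-- Subsets of given size, images, and Berge hypergraphs from matchings

choose : ∀ n → ℕ → List (Subset n)
choose zero    zero    = [] ∷ []
choose zero    (suc k) = []
choose (suc n) zero    = map (outside ∷_) (choose n zero)
choose (suc n) (suc k) = map (outside ∷_) (choose n (suc k)) ++ map (inside ∷_) (choose n k)

∈-choose : ∀ {n k} (p : Subset n) → ∣ p ∣ ≡ k → p ∈ᴸ choose n k
∈-choose             []            refl = here refl
∈-choose {k = zero}  (outside ∷ p) eq = ∈-map⁺ _ (∈-choose p eq)
∈-choose {k = suc k} (outside ∷ p) eq = ∈-++⁺ˡ (∈-map⁺ _ (∈-choose p eq))
∈-choose             (inside ∷ p)  refl = ∈-++⁺ʳ _ (∈-map⁺ _ (∈-choose p refl))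

edge-≡ : ∀ {H} {d e : Edge H} → proj₁ d ≡ proj₁ e → d ≡ e
edge-≡ refl = cong (_ ,_) (T-irrelevant _ _)

module _ {m n} (f : Fin m → Fin n) where

  ∈-image⁺ : ∀ {p x} → x ∈ p → f x ∈ image f p
  ∈-image⁺ {p} {x} x∈p = lookup⇒[]= (f x) _ (trans (lookup∘tabulate _ (f x))
    (dec-true (any? λ z → (z ∈? p) ×-dec (f z ≟ᶠ f x)) (x , x∈p , refl)))

  ∈-image⁻ : ∀ {p y} → y ∈ image f p → ∃[ x ] x ∈ p × f x ≡ y
  ∈-image⁻ {p} {y} y∈ with any? (λ x → (x ∈? p) ×-dec (f x ≟ᶠ y))
                         | trans (sym (lookup∘tabulate _ y)) ([]=⇒lookup y∈)
  ... | yes w | _ = w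
  ... | no _  | ()

  image-injective : Injective _≡_ _≡_ f → Injective _≡_ _≡_ (image f)
  image-injective f-inj eq = ⊆-antisym (image⊆⇒⊆ eq) (image⊆⇒⊆ (sym eq))
    where
    image⊆⇒⊆ : ∀ {p q} → image f p ≡ image f q → p ⊆ q
    image⊆⇒⊆ {p} {q} eq x∈p with x′ , x′∈q , e ← ∈-image⁻ (subst (f _ ∈_) eq (∈-image⁺ x∈p)) =
      subst (_∈ q) (f-inj e) x′∈q

image-id : ∀ {n} (p : Subset n) → image id p ≡ p
image-id p = ⊆-antisym (λ y∈ → let _ , x∈p , x≡y = ∈-image⁻ id y∈ in subst (_∈ p) x≡y x∈p)
                       (∈-image⁺ id)

-- Each edge of `K m` goes to the hyperedge matched with its image under `f`. Distinct edges have
-- distinct images, hence distinct partners.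
matching⇒berge : ∀ {m} (H : Hypergraph) {es} (f : Fin m → Vertex H) → Injective _≡_ _≡_ f →
                 All (T ∘ isEdge H) es →
                 PerfectMatching _⊆_ (map (image f) (choose m 2)) es → ℬ (K m) H
matching⇒berge {m} H {es} f f-inj es⊆H M = record
  { φ           = f
  ; φ-injective = f-inj
  ; ε           = λ xy → let e , e∈es , _ = host xy in e , All.lookup es⊆H e∈es
  ; ε-injective = λ {xy} {xy′} eq → edge-≡ {complete 2 m} (image-injective f f-inj
      (partner-injective _⊆_ M (position xy) (position xy′) (cong proj₁ eq)))
  ; incident    = λ xy x x∈xy → proj₂ (proj₂ (host xy)) (∈-image⁺ f x∈xy)
  }
  where
  position : (xy : Edge (complete 2 m)) → image f (proj₁ xy) ∈ᴸ map (image f) (choose m 2)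
  position (p , h) = ∈-map⁺ (image f) (∈-choose p (toWitness h))

  host : (xy : Edge (complete 2 m)) → ∃[ e ] e ∈ᴸ es × image f (proj₁ xy) ⊆ e
  host xy = partner _⊆_ M (position xy)

-- Colour classes and the search over two-colourings

module _ {k} (L : Hypergraph) (χ : Coloring k L) where

  Coloured : Fin k → Subset (order L) → Set
  Coloured c p = Σ[ h ∈ T (isEdge L p) ] χ (p , h) ≡ c

  coloured? : ∀ c p → Dec (Coloured c p)
  coloured? c p with T? (isEdge L p)
  ... | no ¬h = no (¬h ∘ proj₁)
  ... | yes h with χ (p , h) ≟ᶠ c
  ...   | yes eq = yes (h , eq)
  ...   | no ¬eq = no λ (h′ , eq) →
                     ¬eq (subst (λ h → χ (p , h) ≡ c) (T-irrelevant h′ h) eq)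

  -- `IsBerge` asks `ε` to be injective only, so a whole colour class can serve as the monochromatic
  -- Berge hypergraph.
  colourClass : Fin k → Hypergraph
  colourClass c = record { order = order L ; isEdge = λ p → isYes (coloured? c p) }

  colourClass-monochromatic : ∀ c → MonochromaticIn L χ (colourClass c)
  colourClass-monochromatic c = record
    { ι             = id
    ; ι-injective   = id
    ; colour        = c
    ; monochromatic = λ (p , h) → subst (Coloured c) (sym (image-id p)) (toWitness h)
    }

-- Colouring the pending edges in any way, and then at most one more edge from
-- extra, produces a matching of a member of F into the red or into the blue
-- edges.  F is a parameter so that its evaluation is shared by the whole search.
module Search {n} (F : List (List (Subset n))) (extra : List (Subset n)) where

  -- The comparison of lengths is redundant but prunes the search.
  Matched : List (Subset n) → Set
  Matched es = Any (λ ps → length ps ≡ length es × PerfectMatching _⊆_ ps es) F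

  matched? : ∀ es → Dec (Matched es)
  matched? es =
    Any.any? (λ ps → (length ps ≟ length es) ×-dec perfectMatching? _⊆_ _⊆?_ _≟ˢ_ ps es) F

  Unavoidable Continues : (pending red blue : List (Subset n)) → Set

  Unavoidable ts R B = Matched R ⊎ Matched B ⊎ Continues ts R B

  Continues []       R B = Any (λ t → Matched (t ∷ R) × Matched (t ∷ B)) extra
  Continues (t ∷ ts) R B = Unavoidable ts (t ∷ R) B × Unavoidable ts R (t ∷ B)

  unavoidable? : ∀ ts R B → Dec (Unavoidable ts R B)
  continues?   : ∀ ts R B → Dec (Continues ts R B)

  unavoidable? ts R B = matched? R ⊎-dec matched? B ⊎-dec continues? ts R B

  continues? []       R B = Any.any? (λ t → matched? (t ∷ R) ×-dec matched? (t ∷ B)) extra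
  continues? (t ∷ ts) R B = unavoidable? ts (t ∷ R) B ×-dec unavoidable? ts R (t ∷ B)

-- Upper bound: six vertices suffice

core : Fin 5 → Fin 4 → Fin 6
-- Vertex `zero` is the fixed sixth vertex. Of the other five, `suc w` is left out; these five cores
-- are enough for the search.
core w = suc ∘ punchIn w

core-injective : ∀ w → Injective _≡_ _≡_ (core w)
core-injective w = punchIn-injective w _ _ ∘ suc-injective

corePairs : Fin 5 → List (Subset 6)
corePairs w = map (image (core w)) (choose 4 2)

avoiding₀ containing₀ : List (Subset 6)
avoiding₀   = map (outside ∷_) (choose 5 3)
containing₀ = map (inside ∷_) (choose 5 2)

triples? : ∀ ts → Dec (All (T ∘ isEdge (complete 3 6)) ts)
triples? = All.all? (λ t → T? (isEdge (complete 3 6) t))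

containing₀-edges : All (T ∘ isEdge (complete 3 6)) containing₀
containing₀-edges = toWitness {a? = triples? containing₀} tt

open Search (map corePairs (allFin 5)) containing₀

-- Checking `does` keeps memory small: `toWitness` would retain the evidence
-- accumulated by the whole search.
does⇒ : ∀ {A : Set} (a? : Dec A) → does a? ≡ true → A
does⇒ (yes a) _ = a

-- A branch closes once a class has six triples; the 252 branches left are the 5-5 splits, each
-- settled by a triple from `containing₀`.
unavoidable : Unavoidable avoiding₀ [] []
unavoidable = does⇒ (unavoidable? avoiding₀ [] []) refl

module _ (χ : Coloring 2 (complete 3 6)) where

  Class : Fin 2 → Hypergraph
  Class = colourClass (complete 3 6) χ

  MonochromaticBergeK₄ : Set
  MonochromaticBergeK₄ = ∃[ H ] ℬ (K 4) H × MonochromaticIn (complete 3 6) χ H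

  matched⇒monochromatic : ∀ c {es} → All (T ∘ isEdge (Class c)) es → Matched es →
                          MonochromaticBergeK₄
  matched⇒monochromatic c es⊆ r =
    let w , _ , s = Any.satisfied (map⁻ {f = corePairs} {xs = allFin 5} r) in
    Class c , matching⇒berge (Class c) (core w) (core-injective w) es⊆ s ,
    colourClass-monochromatic (complete 3 6) χ c

  red-or-blue : ∀ {p} → T (isEdge (complete 3 6) p) →
                T (isEdge (Class zero) p) ⊎ T (isEdge (Class (suc zero)) p)
  red-or-blue {p} h with χ (p , h) in eq
  ... | zero     = inj₁ (fromWitness (h , eq))
  ... | suc zero = inj₂ (fromWitness (h , eq))

  -- `χ` selects one path down the search tree; along it `R` and `B` stay inside the two colour
  -- classes.
  unavoidable⇒monochromatic : ∀ {ts R B} → All (T ∘ isEdge (complete 3 6)) ts →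
    All (T ∘ isEdge (Class zero)) R → All (T ∘ isEdge (Class (suc zero))) B →
    Unavoidable ts R B → MonochromaticBergeK₄
  unavoidable⇒monochromatic _ R⊆ _ (inj₁ r) = matched⇒monochromatic zero R⊆ r
  unavoidable⇒monochromatic _ _ B⊆ (inj₂ (inj₁ b)) = matched⇒monochromatic (suc zero) B⊆ b
  unavoidable⇒monochromatic [] R⊆ B⊆ (inj₂ (inj₂ any))
    -- The extra triple completes both lists, so either colour of it will do.
    with h , r , b ← All.lookupAny containing₀-edges any with red-or-blue h
  ... | inj₁ red  = matched⇒monochromatic zero (red ∷ R⊆) r
  ... | inj₂ blue = matched⇒monochromatic (suc zero) (blue ∷ B⊆) b
  unavoidable⇒monochromatic (h ∷ hs) R⊆ B⊆ (inj₂ (inj₂ (ifRed , ifBlue))) with red-or-blue h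
  ... | inj₁ red  = unavoidable⇒monochromatic hs (red ∷ R⊆) B⊆ ifRed
  ... | inj₂ blue = unavoidable⇒monochromatic hs R⊆ (blue ∷ B⊆) ifBlue

arrows₆ : Arrows 3 (ℬ (K 4)) 2 6
arrows₆ χ = unavoidable⇒monochromatic χ (toWitness {a? = triples? avoiding₀} tt) [] [] unavoidable

-- Lower bound: colourings with small colour classes

module _ {k l} (L : Hypergraph) {code : Edge L → Fin (k * l)}
         (code-injective : Injective _≡_ _≡_ code) where

  -- Taking quotients cuts the `k * l` codes into `k` blocks of `l`, one block per colour.
  quotientColoring : Coloring k L
  quotientColoring = quotient l ∘ code

  -- Edges of one colour are told apart by the remainder of their code.
  quotientColoring-≤ : ∀ {H s} → MonochromaticIn L quotientColoring H →
                       {ε : Fin s → Edge H} → Injective _≡_ _≡_ ε → s ≤ l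
  quotientColoring-≤ {H} {s} M {ε} ε-inj = injective⇒≤ {f = remainder {k} l ∘ code ∘ edge}
    λ {i} {j} eq → ε-inj (edge-≡ {H} (image-injective ι ι-injective (cong proj₁
      (code-injective {edge i} {edge j} (begin
        code (edge i)                                    ≡⟨ combine-remQuot {k} l _ ⟨
        uncurry combine (remQuot {k} l (code (edge i)))
          ≡⟨ cong₂ combine (trans (proj₂ (monochromatic (ε i)))
                                  (sym (proj₂ (monochromatic (ε j))))) eq ⟩
        uncurry combine (remQuot {k} l (code (edge j)))  ≡⟨ combine-remQuot {k} l _ ⟩
        code (edge j)                                    ∎)))))
    where
    open MonochromaticIn M
    open ≡-Reasoning
    edge : Fin s → Edge L
    edge i = image ι (proj₁ (ε i)) , proj₁ (monochromatic (ε i))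

-- The code of an edge is its position in `choose n r`, widened to `Fin N` so that one `N` serves
-- several `n`.
completeCode : ∀ {r n N} → length (choose n r) ≤ N → Edge (complete r n) → Fin N
completeCode ≤N (p , h) = inject≤ (index (∈-choose p (toWitness h))) ≤N

completeCode-injective : ∀ {r n N} (≤N : length (choose n r) ≤ N) →
                         Injective _≡_ _≡_ (completeCode {r} {n} ≤N)
completeCode-injective {r} {n} ≤N {p , h} {q , h′} eq = edge-≡ {complete r n} (begin
  p                               ≡⟨ lookup-index p∈ ⟩
  lookup (choose n r) (index p∈)  ≡⟨ cong (lookup (choose n r)) (inject≤-injective ≤N ≤N _ _ eq) ⟩
  lookup (choose n r) (index q∈)  ≡⟨ lookup-index q∈ ⟨
  q                               ∎)
  where
  open ≡-Reasoning
  p∈ = ∈-choose p (toWitness h)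
  q∈ = ∈-choose q (toWitness h′)

K₄-edge : Fin 6 → Edge (complete 2 4)
K₄-edge i = lookup (choose 4 2) i ,
  toWitness {a? = all? λ i → T? (isEdge (complete 2 4) (lookup (choose 4 2) i))} tt i

K₄-edge-injective : Injective _≡_ _≡_ K₄-edge
K₄-edge-injective {i} {j} eq = toWitness
  {a? = all? λ i → all? λ j → (lookup (choose 4 2) i ≟ˢ lookup (choose 4 2) j) →-dec (i ≟ᶠ j)}
  tt i j (cong proj₁ eq)

length-choose₃≤10 : ∀ {m} → m < 6 → length (choose m 3) ≤ 10
length-choose₃≤10 m<6 = subst (λ m → length (choose m 3) ≤ 10) (toℕ-fromℕ< m<6)
  -- Evaluated for each `m` below six; the maximum, ten, occurs at five vertices.
  (toWitness {a? = all? λ (i : Fin 6) → length (choose (toℕ i) 3) ≤? 10} tt (fromℕ< m<6))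

-- With codes in `Fin (2 * 5)` a colour has at most five triples, but the six edges of `K 4` need
-- six of one colour. Every `m` below six is coloured directly, without monotonicity in `m`.
¬arrows : ∀ {m} → m < 6 → ¬ Arrows 3 (ℬ (K 4)) 2 m
¬arrows {m} m<6 arrows = contradiction (quotientColoring-≤ {2} {5} (complete 3 m) injective mono
    {ε = ε ∘ K₄-edge} (K₄-edge-injective ∘ ε-injective)) (<⇒≱ ≤-refl)
  where
  injective : Injective _≡_ _≡_ (completeCode (length-choose₃≤10 m<6))
  injective = completeCode-injective (length-choose₃≤10 m<6)
  mono = proj₂ (proj₂ (arrows (quotientColoring {2} {5} (complete 3 m) injective)))
  open IsBerge (proj₁ (proj₂ (arrows (quotientColoring {2} {5} (complete 3 m) injective))))

theorem4 : R[ 3 ]⟨ ℬ (K 4) , 2 ⟩≡ 6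
theorem4 = arrows₆ , λ m arrows → ≮⇒≥ λ m<6 → ¬arrows m<6 arrows
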